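{- For all positive integers $h,\ell$ with $h>\ell+2$, the tensor product $\prod_{M_\partial\in DM_{h,\ell}}M_\partial^{\triangleleft}$ of the cones of all members of $DM_{h,\ell}$ is a core.
   Context: All digraphs are finite, without loops and parallel arcs; digons (pairs of opposite arcs) are allowed. A homomorphism is a vertex map sending arcs to arcs. The tensor product has as vertex set the Cartesian product, with an arc from $(u_i)_i$ to $(v_i)_i$ iff $u_i\to v_i$ is an arc in every coordinate. A digraph is a core if its only retract (endomorphism $\phi$ with $\phi^2=\phi$) is the identity. The cone $G^{\triangleleft}$ of a digraph $G$ is obtained by adding a new vertex joined by arcs in both directions to every vertex of $G$. For a sequence $\partial=(\partial_1,\dots,\partial_\ell)$ of integers with $1\le \partial_i\le h-2$, the mountain $M_\partial$ of height $h$ is the oriented path which, traversed from its beginning, consists of: one forward arc; then for $i=1,\dots,\ell$ in order, $\partial_i$ consecutive forward arcs followed by $\partial_i$ consecutive backward arcs (the $i$-th peak); then $h-2$ consecutive forward arcs; then one final forward arc. (A forward arc is oriented in the direction of traversal, a backward arc against it.) $DM_{h,\ell}$ is the set of all mountains $M_\partial$ of height $h$ with $\ell$ peaks such that $\partial_1>\partial_2>\dots>\partial_\ell\ge 1$ and $\partial_1=h-2$. -}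

module Defs where

open import Data.Fin.Base using (Fin; zero; suc)
open import Data.List.Base using (List; []; _∷_; _++_; length; head; replicate; concatMap)
open import Data.List.Relation.Unary.All using (All)
open import Data.List.Relation.Unary.Linked using (Linked)
open import Data.Maybe.Base using (Maybe; just; nothing)
import Data.Maybe.Relation.Binary.Pointwise as Maybe
open import Data.Nat.Base using (ℕ; suc; _∸_; _≤_; _>_)
open import Data.Product.Base using (_×_; _,_; proj₁; proj₂)
open import Level using (0ℓ)
open import Relation.Binary.Bundles using (Setoid)
open import Relation.Binary.Core using (Rel)
open import Relation.Binary.Definitions using (_Respects₂_)
open import Relation.Binary.Morphism.Structures using (IsOrderHomomorphism)
open import Relation.Binary.PropositionalEquality using (_≡_; setoid; resp₂)

-- Vertices form a setoid because a vertex of a product is a family of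
-- vertices, and two families are the same vertex when they agree in every
-- coordinate.  An arc relation is a mere relation as far as the notions below
-- are concerned, so there are no parallel arcs.  Finiteness and looplessness
-- are not fields: they hold for paths and cones of paths, and are inherited by
-- products over a nonempty finite index set.
record Digraph : Set₁ where
  infix 4 _⟶_
  field
    vertices : Setoid 0ℓ 0ℓ
  open Setoid vertices public using (_≈_) renaming (Carrier to Vertex)
  field
    _⟶_    : Rel Vertex 0ℓ
    ⟶-resp : _⟶_ Respects₂ _≈_

open Digraph using (Vertex)

-- The library's order homomorphisms carry no order axioms: such a map respects
-- vertex equality and sends arcs to arcs.
IsHomomorphism : (G H : Digraph) → (Vertex G → Vertex H) → Set
IsHomomorphism G H = IsOrderHomomorphism G._≈_ H._≈_ G._⟶_ H._⟶_
  where
  module G = Digraph G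
  module H = Digraph H

IsRetraction : (G : Digraph) → (Vertex G → Vertex G) → Set
IsRetraction G φ = IsHomomorphism G G φ × (∀ u → φ (φ u) ≈ φ u)
  where open Digraph G

IsCore : Digraph → Set
IsCore G = ∀ φ → IsRetraction G φ → ∀ u → φ u ≈ u
  where open Digraph G

∏ : {I : Set} → (I → Digraph) → Digraph
∏ {I} G = record
  { vertices = record
    { Carrier       = ∀ i → G.Vertex i
    ; _≈_           = λ u v → ∀ i → G._≈_ i (u i) (v i)
    ; isEquivalence = record
      { refl  = λ i → Setoid.refl (G.vertices i)
      ; sym   = λ p i → Setoid.sym (G.vertices i) (p i)
      ; trans = λ p q i → Setoid.trans (G.vertices i) (p i) (q i)
      }
    }
  ; _⟶_    = λ u v → ∀ i → G._⟶_ i (u i) (v i)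
  ; ⟶-resp = (λ p a i → proj₁ (G.⟶-resp i) (p i) (a i))
           , (λ p a i → proj₂ (G.⟶-resp i) (p i) (a i))
  }
  where module G (i : I) = Digraph (G i)

module _ (G : Digraph) where
  open Digraph G using (vertices; _≈_; _⟶_; ⟶-resp)

  -- `nothing` is the apex; it carries no loop.
  data ConeArc : Rel (Maybe (Vertex G)) 0ℓ where
    base      : ∀ {u v} → u ⟶ v → ConeArc (just u) (just v)
    from-apex : ∀ {v} → ConeArc nothing (just v)
    to-apex   : ∀ {u} → ConeArc (just u) nothing

  cone : Digraph
  cone = record
    { vertices = Maybe.setoid vertices
    ; _⟶_      = ConeArc
    ; ⟶-resp   = resp-right , resp-left
    }
    where
    resp-right : ∀ {u v w} → Maybe.Pointwise _≈_ v w → ConeArc u v → ConeArc u w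
    resp-right (Maybe.just p) (base a)  = base (proj₁ ⟶-resp p a)
    resp-right (Maybe.just p) from-apex = from-apex
    resp-right Maybe.nothing  to-apex   = to-apex

    resp-left : ∀ {u v w} → Maybe.Pointwise _≈_ v w → ConeArc v u → ConeArc w u
    resp-left (Maybe.just p) (base a)  = base (proj₂ ⟶-resp p a)
    resp-left Maybe.nothing  from-apex = from-apex
    resp-left (Maybe.just p) to-apex   = to-apex

data Direction : Set where
  forward backward : Direction

-- Vertices are numbered in order of traversal; the n-th direction gives the
-- orientation of the arc between vertices n and n + 1.
data PathArc : (ds : List Direction) → Rel (Fin (suc (length ds))) 0ℓ where
  forward  : ∀ {ds} → PathArc (forward ∷ ds) zero (suc zero)
  backward : ∀ {ds} → PathArc (backward ∷ ds) (suc zero) zero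
  later    : ∀ {d ds u v} → PathArc ds u v → PathArc (d ∷ ds) (suc u) (suc v)

orientedPath : List Direction → Digraph
orientedPath ds = record
  { vertices = setoid (Fin (suc (length ds)))
  ; _⟶_      = PathArc ds
  ; ⟶-resp   = resp₂ (PathArc ds)
  }

peak : ℕ → List Direction
peak d = replicate d forward ++ replicate d backward

mountain : (h : ℕ) (∂ : List ℕ) → Digraph
mountain h ∂ = orientedPath
  ((forward ∷ []) ++ concatMap peak ∂ ++ replicate (h ∸ 2) forward ++ (forward ∷ []))

-- The sequences ∂ with M_∂ ∈ DM_{h,ℓ}.  Distinct sequences give distinct
-- mountains, so these index the set DM_{h,ℓ} without repetition.  The
-- conditions are decidable and kept irrelevant, so that elements with the same
-- sequence are equal.
record DM (h ℓ : ℕ) : Set where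
  field
    ∂           : List ℕ
    .length-∂   : length ∂ ≡ ℓ
    .bounded    : All (λ d → 1 ≤ d × d ≤ h ∸ 2) ∂
    .decreasing : Linked _>_ ∂
    .first      : head ∂ ≡ just (h ∸ 2)

M : ∀ {h ℓ} → DM h ℓ → Digraph
M {h} m = mountain h (DM.∂ m)

{-# OPTIONS --safe #-}

-- Every endomorphism of the product is the identity.  Let f map the product of
-- the cones to the cone of P j.  Two vertices whose sets of apex coordinates are
-- complementary span a digon, which P j lacks, so whether f takes the value
-- apex depends only on the set of apex coordinates.  A partition of the index
-- set into three cells carries a directed triangle, which P j lacks as well;
-- hence the sets sent to the apex form an ultrafilter, concentrated at some k.
-- A homomorphism from the bipartite P k to a digon can pass through any given
-- vertices of the other cones, so P k threads through any vertex of the product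
-- and f restricts to a homomorphism P k → P j.  As mountains form a rigid
-- antichain, k = j and f is the j-th projection.
--
-- For mountains, levels force a homomorphism to map ends to ends.  While it
-- traverses one peak it can advance by at most one peak, and only by one of the
-- same height, so equal numbers of peaks force equal sequences.

module Submission where

open import Algebra.Properties.CommutativeSemigroup using (x∙yz≈y∙xz)
open import Data.Bool.Base using (Bool; true; false; not; if_then_else_; _∧_; _xor_)
open import Data.Bool.Properties using (not-involutive; not-¬; not-distribʳ-xor; xor-same)
open import Data.Fin.Base using (Fin; zero; suc; toℕ; fromℕ)
open import Data.Fin.Properties using (toℕ-injective)
open import Data.Integer.Base using (ℤ; +_; 0ℤ; 1ℤ; -1ℤ; _⊖_) renaming (_+_ to _+ᶻ_; -_ to -ᶻ_)
import Data.Integer.Properties as ℤ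
open import Algebra.Properties.AbelianGroup ℤ.+-0-abelianGroup using (∙-cancelˡ)
open import Data.List.Base
  using (List; []; _∷_; _++_; length; replicate; concatMap; cartesianProductWith; upTo)
open import Data.List.Membership.Propositional using (_∈_)
open import Data.List.Membership.Propositional.Properties using (∈-cartesianProductWith⁺; ∈-upTo⁺)
open import Data.List.Properties using (++-assoc; ++-identityʳ; length-++; length-replicate; ≡-dec)
open import Data.List.Relation.Unary.All as All using (All; []; _∷_)
open import Data.List.Relation.Unary.Any using (here; there)
open import Data.Maybe.Base using (Maybe; just; nothing; is-nothing; fromMaybe)
import Data.Maybe.Relation.Binary.Pointwise as Maybe
open import Data.Nat.Base using (ℕ; zero; suc; _+_; _∸_; _⊓_; _≤_; _<_; _>_; z≤n; s≤s)
open import Data.Nat.Properties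
open import Data.Product.Base using (∃; _×_; _,_; proj₁; proj₂)
open import Data.Sum.Base as Sum using (_⊎_; inj₁; inj₂)
open import Function.Base using (_∘_)
open import Function.Definitions using (Injective)
open import Relation.Binary.Bundles using (Setoid)
open import Relation.Binary.Definitions using (Asymmetric; DecidableEquality)
open import Relation.Binary.Morphism.Structures using (IsOrderHomomorphism)
open import Relation.Binary.PropositionalEquality
open import Relation.Nullary using (¬_; yes; no; contradiction; does; recompute; _×-dec_)
open import Defs

open Digraph using (Vertex)

-- Products of cones

-- The colouring rules out directed triangles and `asym` rules out digons. The arc serves
-- coordinates in which two adjacent vertices must both avoid the apex.
record OrientedBipartite (G : Digraph) : Set where
  open Digraph G hiding (Vertex)
  field
    colour      : Vertex G → Bool
    colour-cong : ∀ {u v} → u ≈ v → colour u ≡ colour v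
    alternates  : ∀ {u v} → u ⟶ v → colour v ≡ not (colour u)
    asym        : Asymmetric _⟶_
    {tail head} : Vertex G
    arc         : tail ⟶ head

module _ {G : Digraph} (B : OrientedBipartite G) where
  open Digraph G hiding (Vertex)
  open OrientedBipartite B

  -- The base has no digon and the apex no loop, so a digon joins the apex to a base vertex.
  digon-apex : ∀ {a b} → ConeArc G a b → ConeArc G b a → is-nothing b ≡ not (is-nothing a)
  digon-apex (base p)  (base q)  = contradiction q (asym p)
  digon-apex from-apex to-apex   = refl
  digon-apex to-apex   from-apex = refl

  -- Going round three base arcs would flip a colour three times and yet return to it.
  triangle-apex : ∀ {a b c} → ConeArc G a b → ConeArc G b c → ConeArc G c a →
    is-nothing c ≡ false → is-nothing a ≡ true ⊎ is-nothing b ≡ true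
  triangle-apex (base p) (base q) (base r) _ = contradiction
    (trans (alternates r) (cong not (trans (alternates q) (cong not (alternates p)))))
    (not-¬ (sym (not-involutive _)))
  triangle-apex from-apex _       _       _ = inj₁ refl
  triangle-apex to-apex   _       _       _ = inj₂ refl

  -- The apex is joined in both directions, so exchanging `a` and `b` completes a digon.
  opposite-arc : ∀ {a b : Maybe (Vertex G)} → is-nothing b ≡ not (is-nothing a) → ConeArc G a b
  opposite-arc {just _}  {nothing} _ = to-apex
  opposite-arc {nothing} {just _}  _ = from-apex

  -- m and other m span a digon of the cone, whatever m is.
  other : Maybe (Vertex G) → Maybe (Vertex G)
  other (just _) = nothing
  other nothing  = just tail

  zigzag : Bool → Maybe (Vertex G) → Maybe (Vertex G)
  zigzag b m = if b then other m else m

  zigzag-opposite : ∀ b m → is-nothing (zigzag (not b) m) ≡ not (is-nothing (zigzag b m))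
  zigzag-opposite true  (just _) = refl
  zigzag-opposite true  nothing  = refl
  zigzag-opposite false (just _) = refl
  zigzag-opposite false nothing  = refl

-- Equality of indices is decided on their codes, and finiteness of `I` is expressed by a list that
-- covers all codes. An entry of the list may be the code of no index.
module ConeProduct
  {I C : Set} (P : I → Digraph) (P-ob : ∀ i → OrientedBipartite (P i))
  (_≟_ : DecidableEquality C) (code : I → C) (code-injective : Injective _≡_ _≡_ code)
  (codes : List C) (code∈codes : ∀ i → code i ∈ codes)
  where

  module P (i : I) = Digraph (P i)
  module O (i : I) = OrientedBipartite (P-ob i)

  private
    G : Digraph
    G = ∏ (λ i → cone (P i))
    module G = Digraph G

  support : Vertex G → I → Bool
  support u = is-nothing ∘ u

  -- The copy of P k through u, for u k = just x: in every other coordinate i it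
  -- alternates, by colour, between the ends of a digon through u i.
  thread : ∀ k → Vertex G → Vertex (P k) → Vertex (P k) → Vertex G
  thread k u x y i with code i ≟ code k
  ... | yes eq = just (subst (Vertex ∘ P) (sym (code-injective eq)) y)
  ... | no _   = zigzag (P-ob i) (O.colour k x xor O.colour k y) (u i)

  -- An arc of `P k` flips the colour, so every other coordinate moves to the opposite end of its
  -- digon.
  thread-mono : ∀ {k u x y z} → P._⟶_ k y z → thread k u x y G.⟶ thread k u x z
  thread-mono {k} {u} {x} {y} {z} y⟶z i with code i ≟ code k
  ... | yes eq with code-injective eq
  ...   | refl = base y⟶z
  thread-mono {k} {u} {x} {y} {z} y⟶z i | no _ = opposite-arc (P-ob i) (begin
    is-nothing (zig (c xor O.colour k z))
      ≡⟨ cong (λ b → is-nothing (zig (c xor b))) (O.alternates k y⟶z) ⟩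
    is-nothing (zig (c xor not (O.colour k y)))
      ≡⟨ cong (is-nothing ∘ zig) (sym (not-distribʳ-xor c _)) ⟩
    is-nothing (zig (not (c xor O.colour k y)))
      ≡⟨ zigzag-opposite (P-ob i) (c xor O.colour k y) (u i) ⟩
    not (is-nothing (zig (c xor O.colour k y))) ∎)
    where
    open ≡-Reasoning
    c = O.colour k x
    zig = λ b → zigzag (P-ob i) b (u i)

  thread-cong : ∀ {k u x y z} → P._≈_ k y z → thread k u x y G.≈ thread k u x z
  thread-cong {k} {u} {x} {y} {z} y≈z i with code i ≟ code k
  ... | yes eq with code-injective eq
  ...   | refl = Maybe.just y≈z
  thread-cong {k} {u} {x} {y} {z} y≈z i | no _ = Maybe.reflexive
    (λ { refl → Setoid.refl (P.vertices i) })
    (cong (λ b → zigzag (P-ob i) (O.colour k x xor b) (u i)) (O.colour-cong k y≈z))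

  -- At `x` the two colours cancel in the `xor`, and `zigzag` leaves the other coordinates of `u`
  -- alone.
  thread-self : ∀ {k u x} → Maybe.Pointwise (P._≈_ k) (u k) (just x) → thread k u x x G.≈ u
  thread-self {k} {u} {x} p i with code i ≟ code k
  ... | yes eq with code-injective eq
  ...   | refl = Setoid.sym (Maybe.setoid (P.vertices i)) p
  thread-self {k} {u} {x} p i | no _ = Maybe.reflexive
    (λ { refl → Setoid.refl (P.vertices i) })
    (cong (λ b → zigzag (P-ob i) b (u i)) (xor-same (O.colour k x)))

  thread-support : ∀ {k u x y} → support (thread k u x y) k ≡ false
  thread-support {k} with code k ≟ code k
  ... | yes _ = refl
  ... | no ¬p = contradiction refl ¬p

  module _ {j : I} {f : Vertex G → Vertex (cone (P j))} (f-hom : IsHomomorphism G (cone (P j)) f)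
    where

    open IsOrderHomomorphism f-hom using (mono) renaming (cong to f-cong)

    private
      mask : (I → Bool) → Vertex G
      mask χ i = if χ i then nothing else just (O.tail i)

      mask-support : ∀ χ i → support (mask χ) i ≡ χ i
      mask-support χ i with χ i
      ... | true  = refl
      ... | false = refl

    -- Membership in the ultrafilter, tested on one representative vertex with apex set `χ`; by
    -- `apex≡large` every other representative gives the same answer.
    large : (I → Bool) → Bool
    large χ = is-nothing (f (mask χ))

    complement-apex : ∀ {u v} → (∀ i → support v i ≡ not (support u i)) →
      is-nothing (f v) ≡ not (is-nothing (f u))
    complement-apex {u} {v} opp = digon-apex (P-ob j)
      (mono (λ i → opposite-arc (P-ob i) (opp i)))
      (mono (λ i → opposite-arc (P-ob i) (trans (sym (not-involutive _)) (cong not (sym (opp i))))))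

    large-not : ∀ χ → large (not ∘ χ) ≡ not (large χ)
    large-not χ = complement-apex
      (λ i → trans (mask-support (not ∘ χ) i) (cong not (sym (mask-support χ i))))

    -- Both `u` and `mask χ` are opposite to `mask (not ∘ χ)`, so `f` sends both or neither to the
    -- apex.
    apex≡large : ∀ {u χ} → (∀ i → support u i ≡ χ i) → is-nothing (f u) ≡ large χ
    apex≡large {u} {χ} s = begin
      is-nothing (f u)             ≡⟨ not-involutive _ ⟨
      not (not (is-nothing (f u)))
        ≡⟨ cong not (complement-apex
             (λ i → trans (mask-support (not ∘ χ) i) (cong not (sym (s i))))) ⟨
      not (large (not ∘ χ))        ≡⟨ cong not (large-not χ) ⟩
      not (not (large χ))          ≡⟨ not-involutive _ ⟩
      large χ ∎
      where open ≡-Reasoning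

    -- Vertices with disjoint apex sets can be joined by an arc: where neither is the apex, `tail`
    -- leads to `head`. The image of that arc cannot be a loop at the apex.
    disjoint⇒¬both-large : ∀ χ ψ → (∀ i → χ i ∧ ψ i ≡ false) →
      large χ ≡ true → large ψ ≡ false
    disjoint⇒¬both-large χ ψ disj χ-large =
      trans (sym (apex≡large v-support))
        (apex-arc (mono u⟶v) (trans (apex≡large (mask-support χ)) χ-large))
      where
      v : Vertex G
      v i = if ψ i then nothing else just (O.head i)

      v-support : ∀ i → support v i ≡ ψ i
      v-support i with ψ i
      ... | true  = refl
      ... | false = refl

      u⟶v : mask χ G.⟶ v
      u⟶v i with χ i | ψ i | disj i
      ... | true  | false | _ = from-apex
      ... | false | true  | _ = to-apex
      ... | false | false | _ = base (O.arc i)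

      apex-arc : ∀ {a b} → ConeArc (P j) a b → is-nothing a ≡ true → is-nothing b ≡ false
      apex-arc from-apex _ = refl

    -- The three cells of a partition of I are the supports of the vertices of a
    -- directed triangle.
    large-split : ∀ (χ ψ : I → Bool) → large χ ≡ true →
      large (λ i → χ i ∧ ψ i) ≡ true ⊎ large (λ i → χ i ∧ not (ψ i)) ≡ true
    large-split χ ψ χ-large = Sum.map
      (trans (sym (apex≡large a-support)))
      (trans (sym (apex≡large b-support)))
      (triangle-apex (P-ob j) (mono a⟶b) (mono b⟶c) (mono c⟶a)
        (trans (apex≡large c-support) (trans (large-not χ) (cong not χ-large))))
      where
      a-at b-at c-at : ∀ i → Bool → Bool → Maybe (Vertex (P i))
      a-at i true  true  = nothing
      a-at i true  false = just (O.head i)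
      a-at i false _     = just (O.tail i)
      b-at i true  true  = just (O.tail i)
      b-at i true  false = nothing
      b-at i false _     = just (O.head i)
      c-at i true  true  = just (O.head i)
      c-at i true  false = just (O.tail i)
      c-at i false _     = nothing

      a b c : Vertex G
      a i = a-at i (χ i) (ψ i)
      b i = b-at i (χ i) (ψ i)
      c i = c-at i (χ i) (ψ i)

      a⟶b : a G.⟶ b
      a⟶b i with χ i | ψ i
      ... | true  | true  = from-apex
      ... | true  | false = to-apex
      ... | false | _     = base (O.arc i)

      b⟶c : b G.⟶ c
      b⟶c i with χ i | ψ i
      ... | true  | true  = base (O.arc i)
      ... | true  | false = from-apex
      ... | false | _     = to-apex

      c⟶a : c G.⟶ a
      c⟶a i with χ i | ψ i
      ... | true  | true  = to-apex
      ... | true  | false = base (O.arc i)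
      ... | false | _     = from-apex

      c-support : ∀ i → support c i ≡ not (χ i)
      c-support i with χ i | ψ i
      ... | true  | true  = refl
      ... | true  | false = refl
      ... | false | _     = refl

      a-support : ∀ i → support a i ≡ χ i ∧ ψ i
      a-support i with χ i | ψ i
      ... | true  | true  = refl
      ... | true  | false = refl
      ... | false | _     = refl

      b-support : ∀ i → support b i ≡ χ i ∧ not (ψ i)
      b-support i with χ i | ψ i
      ... | true  | true  = refl
      ... | true  | false = refl
      ... | false | _     = refl

    -- The empty set is disjoint from itself.
    empty-small : ∀ {χ} → (∀ i → χ i ≡ false) → large χ ≡ false
    empty-small {χ} χ-empty with large χ in eq
    ... | false = refl
    ... | true  = trans (sym eq)
      (disjoint⇒¬both-large χ χ (λ i → cong (_∧ χ i) (χ-empty i)) eq)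

    -- An ultrafilter on a finite set is principal.
    principal : ∀ cs χ → (∀ i → χ i ≡ true → code i ∈ cs) → large χ ≡ true →
      ∃ λ c → ∃ λ χ → (∀ i → χ i ≡ true → code i ≡ c) × large χ ≡ true
    principal [] χ χ⊆cs χ-large =
      contradiction (trans (sym χ-large) (empty-small χ-empty)) λ ()
      where
      χ-empty : ∀ i → χ i ≡ false
      χ-empty i with χ i in eq
      ... | false = refl
      ... | true with () ← χ⊆cs i eq
    principal (c ∷ cs) χ χ⊆cs χ-large with large-split χ (λ i → does (code i ≟ c)) χ-large
    ... | inj₁ l = c , _ , at-c , l
      where
      at-c : ∀ i → χ i ∧ does (code i ≟ c) ≡ true → code i ≡ c
      at-c i p with χ i | code i ≟ c
      at-c i p  | true  | yes q = q
      at-c i () | true  | no _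
      at-c i () | false | _
    ... | inj₂ l = principal cs _ off-c l
      where
      off-c : ∀ i → χ i ∧ not (does (code i ≟ c)) ≡ true → code i ∈ cs
      off-c i p with χ i in eq | code i ≟ c
      off-c i () | true  | yes _
      off-c i () | false | _
      off-c i p  | true  | no ¬q with χ⊆cs i eq
      ... | here q  = contradiction q ¬q
      ... | there q = q

    -- Only one implication is recorded; the converse comes from passing to an opposite vertex.
    DependsOn : I → Set
    DependsOn k = ∀ u → support u k ≡ false → is-nothing (f u) ≡ false

    -- A support that misses `k` is disjoint from a large set contained in the singleton of `k`.
    concentrated⇒dependsOn : ∀ {k} χ → (∀ i → χ i ≡ true → i ≡ k) → large χ ≡ true → DependsOn k
    concentrated⇒dependsOn {k} χ χ⊆k χ-large u u-k = trans (apex≡large (λ _ → refl))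
      (disjoint⇒¬both-large χ (support u) disj χ-large)
      where
      disj : ∀ i → χ i ∧ support u i ≡ false
      disj i with χ i in eq
      ... | false = refl
      ... | true with refl ← χ⊆k i eq = u-k

    module _ {k : I} (dep : DependsOn k) (u : Vertex G) (x : Vertex (P k)) where

      -- The default value is never taken: a thread avoids the apex in coordinate `k`, hence so does
      -- its image under `f`.
      pullback : Vertex (P k) → Vertex (P j)
      pullback y = fromMaybe (O.tail j) (f (thread k u x y))

      just-pullback : ∀ y → f (thread k u x y) ≡ just (pullback y)
      just-pullback y with f (thread k u x y) | dep (thread k u x y) (thread-support {k} {u} {x} {y})
      ... | just _ | _ = refl

      pullback-hom : IsHomomorphism (P k) (P j) pullback
      pullback-hom = record
        { cong = λ {y} {z} y≈z → Maybe.drop-just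
            (subst₂ (Maybe.Pointwise (P._≈_ j)) (just-pullback y) (just-pullback z)
              (f-cong (thread-cong {k} {u} {x} y≈z)))
        ; mono = λ {y} {z} y⟶z → drop-base
            (subst₂ (ConeArc (P j)) (just-pullback y) (just-pullback z)
              (mono (thread-mono {k} {u} {x} y⟶z)))
        }
        where
        drop-base : ∀ {a b} → ConeArc (P j) (just a) (just b) → P._⟶_ j a b
        drop-base (base p) = p

  module _
    (antichain : ∀ {k j g} → IsHomomorphism (P k) (P j) g → k ≡ j)
    (rigid     : ∀ {j g} → IsHomomorphism (P j) (P j) g → ∀ x → P._≈_ j (g x) x)
    {j : I} {f : Vertex G → Vertex (cone (P j))} (f-hom : IsHomomorphism G (cone (P j)) f)
    where

    open IsOrderHomomorphism f-hom using () renaming (cong to f-cong)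

    -- The ultrafilter is concentrated on a code `c`. If `c` is not the code of `j`, an index `k`
    -- with code `c` would give a homomorphism from `P k` to `P j`, contrary to the antichain
    -- property; so the large set would be empty.
    f-dependsOn : DependsOn f-hom j
    f-dependsOn with principal f-hom codes (λ _ → true) (λ i _ → code∈codes i) all-large
      where
      all-large : large f-hom (λ _ → true) ≡ true
      -- The full set is the complement of the empty one, which is small.
      all-large = trans (large-not f-hom (λ _ → false)) (cong not (empty-small f-hom (λ _ → refl)))
    ... | c , χ , χ⊆c , χ-large with c ≟ code j
    ...   | yes refl = concentrated⇒dependsOn f-hom χ (λ i p → code-injective (χ⊆c i p)) χ-large
    ...   | no c≢j   = contradiction (trans (sym χ-large) (empty-small f-hom χ-empty)) λ ()
      where
      χ-empty : ∀ k → χ k ≡ false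
      χ-empty k with χ k in eq
      ... | false = refl
      ... | true  = contradiction
        (trans (sym (χ⊆c k eq))
          -- Any thread along `k` will do here, so its base vertex is arbitrary.
          (cong code (antichain (pullback-hom f-hom k-dep (λ _ → nothing) (O.tail k)))))
        c≢j
        where
        k-dep : DependsOn f-hom k
        k-dep = concentrated⇒dependsOn f-hom χ
          (λ i p → code-injective (trans (χ⊆c i p) (sym (χ⊆c k eq)))) χ-large

    -- If `u j` is a base vertex, `u` lies on its own thread along `j`, where rigidity makes `f` the
    -- identity. If `u j` is the apex, an opposite vertex avoids the apex under `f`, so `u` is sent
    -- to it.
    f-projection : ∀ u → Maybe.Pointwise (P._≈_ j) (f u) (u j)
    f-projection u with u j in eq
    ... | just x = Setoid.trans S
      (f-cong (Setoid.sym G.vertices (thread-self {j} {u} {x} (Setoid.reflexive S eq))))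
      (Setoid.trans S (Setoid.reflexive S (just-pullback f-hom f-dependsOn u x x))
        (Maybe.just (rigid (pullback-hom f-hom f-dependsOn u x) x)))
      where S = Maybe.setoid (P.vertices j)
    ... | nothing with f u | apex
      where
      opposite : Vertex G
      opposite i = other (P-ob i) (u i)

      opposite-support : ∀ i → support u i ≡ not (support opposite i)
      opposite-support i with u i
      ... | just _  = refl
      ... | nothing = refl

      apex : is-nothing (f u) ≡ true
      apex = trans (complement-apex f-hom opposite-support)
        (cong not (f-dependsOn opposite
          (trans (sym (not-involutive _))
            (cong not (trans (sym (opposite-support j)) (cong is-nothing eq))))))
    ...   | nothing | _ = Maybe.nothing

  endomorphism-identity :
    (∀ {k j g} → IsHomomorphism (P k) (P j) g → k ≡ j) →
    (∀ {j g} → IsHomomorphism (P j) (P j) g → ∀ x → P._≈_ j (g x) x) →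
    ∀ {φ} → IsHomomorphism G G φ → ∀ u → φ u G.≈ u
  endomorphism-identity antichain rigid φ-hom u j = f-projection antichain rigid
    (record { cong = λ p → φ.cong p j ; mono = λ p → φ.mono p j }) u
    where module φ = IsOrderHomomorphism φ-hom

-- Levels

private variable
  d : Direction
  ds es : List Direction

step : Direction → ℤ
step forward  = 1ℤ
step backward = -1ℤ

-- Constant from the end of the path on.
level : List Direction → ℕ → ℤ
level ds       zero    = 0ℤ
level []       (suc n) = 0ℤ
level (d ∷ ds) (suc n) = step d +ᶻ level ds n

net : List Direction → ℤ
net ds = level ds (length ds)

level-beyond : ∀ ds {n} → length ds ≤ n → level ds n ≡ net ds
level-beyond []       {zero}  _         = refl
level-beyond []       {suc n} _         = refl
level-beyond (d ∷ ds) {suc n} (s≤s len) = cong (step d +ᶻ_) (level-beyond ds len)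

level-++ : ∀ as bs n → level (as ++ bs) n ≡ level as n +ᶻ level bs (n ∸ length as)
level-++ []       bs zero    = refl
level-++ []       bs (suc n) = sym (ℤ.+-identityˡ _)
level-++ (a ∷ as) bs zero    = refl
level-++ (a ∷ as) bs (suc n) = trans (cong (step a +ᶻ_) (level-++ as bs n))
  (sym (ℤ.+-assoc (step a) (level as n) _))

level-++-past : ∀ as bs s → level (as ++ bs) (length as + s) ≡ net as +ᶻ level bs s
level-++-past as bs s = trans (level-++ as bs (length as + s))
  (cong₂ _+ᶻ_ (level-beyond as (m≤m+n (length as) s)) (cong (level bs) (m+n∸m≡n (length as) s)))

net-++ : ∀ as bs → net (as ++ bs) ≡ net as +ᶻ net bs
net-++ as bs = trans (cong (level (as ++ bs)) (length-++ as)) (level-++-past as bs (length bs))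

level-forward : ∀ n s → level (replicate n forward) s ≡ + (s ⊓ n)
level-forward n       zero    = refl
level-forward zero    (suc s) = refl
level-forward (suc n) (suc s) = cong (1ℤ +ᶻ_) (level-forward n s)

level-backward : ∀ n s → level (replicate n backward) s ≡ -ᶻ (+ (s ⊓ n))
level-backward n       zero    = refl
level-backward zero    (suc s) = refl
level-backward (suc n) (suc s) = trans (cong (-1ℤ +ᶻ_) (level-backward n s))
  (sym (ℤ.neg-distrib-+ 1ℤ (+ (s ⊓ n))))

net-forward : ∀ n → net (replicate n forward) ≡ + n
net-forward n = trans (level-forward n _)
  (cong +_ (m≥n⇒m⊓n≡n (≤-reflexive (sym (length-replicate n)))))

net-backward : ∀ n → net (replicate n backward) ≡ -ᶻ (+ n)
net-backward n = trans (level-backward n _)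
  (cong (λ m → -ᶻ (+ m)) (m≥n⇒m⊓n≡n (≤-reflexive (sym (length-replicate n)))))

net-peak : ∀ n → net (peak n) ≡ 0ℤ
net-peak n = begin
  net (peak n)                                            ≡⟨ net-++ (replicate n forward) _ ⟩
  net (replicate n forward) +ᶻ net (replicate n backward)
    ≡⟨ cong₂ _+ᶻ_ (net-forward n) (net-backward n) ⟩
  + n +ᶻ (-ᶻ (+ n))                                       ≡⟨ ℤ.+-inverseʳ (+ n) ⟩
  0ℤ ∎
  where open ≡-Reasoning

length-peak : ∀ n → length (peak n) ≡ n + n
length-peak n = trans (length-++ (replicate n forward))
  (cong₂ _+_ (length-replicate n) (length-replicate n))

level-slope : ∀ n bs {s} → s ≤ n → level (peak n ++ bs) s ≡ + s
level-slope n bs {s} s≤n = begin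
  level (peak n ++ bs) s
    ≡⟨ cong (λ l → level l s) (++-assoc (replicate n forward) _ bs) ⟩
  level (replicate n forward ++ _) s ≡⟨ level-++ (replicate n forward) _ s ⟩
  level (replicate n forward) s +ᶻ level _ (s ∸ length (replicate n forward))
    ≡⟨ cong₂ _+ᶻ_ (trans (level-forward n s) (cong +_ (m≤n⇒m⊓n≡m s≤n)))
        (cong (level _) (m≤n⇒m∸n≡0 (subst (s ≤_) (sym (length-replicate n)) s≤n))) ⟩
  + s +ᶻ 0ℤ ≡⟨ ℤ.+-identityʳ (+ s) ⟩
  + s ∎
  where open ≡-Reasoning

level-past-top : ∀ n bs → level (peak (suc n) ++ bs) (suc n + 1) ≡ + n
level-past-top n bs = begin
  level (peak (suc n) ++ bs) (suc n + 1) ≡⟨ cong (λ l → level l (suc n + 1)) (++-assoc up _ bs) ⟩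
  level (up ++ down) (suc n + 1)
    ≡⟨ cong (λ m → level (up ++ down) (m + 1)) (length-replicate (suc n)) ⟨
  level (up ++ down) (length up + 1)     ≡⟨ level-++-past up down 1 ⟩
  net up +ᶻ -1ℤ                          ≡⟨ cong (_+ᶻ -1ℤ) (net-forward (suc n)) ⟩
  + n ∎
  where
  open ≡-Reasoning
  up = replicate (suc n) forward
  down = replicate (suc n) backward ++ bs

-- Walks

arc-level : ∀ {u v} → PathArc es u v → level es (toℕ v) ≡ 1ℤ +ᶻ level es (toℕ u)
arc-level forward  = refl
arc-level backward = refl
arc-level (later {d} {ds} {u} {v} a) = trans (cong (step d +ᶻ_) (arc-level a))
  (x∙yz≈y∙xz ℤ.+-commutativeSemigroup (step d) 1ℤ (level ds (toℕ u)))

arc-adjacent : ∀ {u v} → PathArc es u v → toℕ v ≡ suc (toℕ u) ⊎ toℕ u ≡ suc (toℕ v)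
arc-adjacent forward  = inj₁ refl
arc-adjacent backward = inj₂ refl
arc-adjacent (later a) with arc-adjacent a
... | inj₁ p = inj₁ (cong suc p)
... | inj₂ p = inj₂ (cong suc p)

arc-asym : Asymmetric (PathArc es)
arc-asym (later a) (later b) = arc-asym a b

data Step (es : List Direction) : Direction → (u v : Fin (suc (length es))) → Set where
  forward  : ∀ {u v} → PathArc es u v → Step es forward  u v
  backward : ∀ {u v} → PathArc es v u → Step es backward u v

infixr 5 _∷_

-- A walk in the path `es` whose successive arcs have the orientations `ds`; it may turn back.
-- Images of the path `ds` under homomorphisms have this form.
data Walk (es : List Direction) : List Direction → (u v : Fin (suc (length es))) → Set where
  []  : ∀ {u} → Walk es [] u u
  _∷_ : ∀ {u v w} → Step es d u v → Walk es ds v w → Walk es (d ∷ ds) u w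

walk-split : ∀ as {bs u w} → Walk es (as ++ bs) u w → ∃ λ v → Walk es as u v × Walk es bs v w
walk-split []       p       = _ , [] , p
walk-split (a ∷ as) (s ∷ p) with v , q , r ← walk-split as p = v , s ∷ q , r

step-level : ∀ {u v} → Step es d u v → level es (toℕ v) ≡ step d +ᶻ level es (toℕ u)
step-level (forward a) = arc-level a
step-level {es = es} (backward {u} {v} a) = begin
  level es (toℕ v)                ≡⟨ ℤ.+-identityˡ _ ⟨
  (-1ℤ +ᶻ 1ℤ) +ᶻ level es (toℕ v) ≡⟨ ℤ.+-assoc -1ℤ 1ℤ (level es (toℕ v)) ⟩
  -1ℤ +ᶻ (1ℤ +ᶻ level es (toℕ v)) ≡⟨ cong (-1ℤ +ᶻ_) (arc-level a) ⟨
  -1ℤ +ᶻ level es (toℕ u) ∎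
  where open ≡-Reasoning

-- The change of level is determined by the orientations alone, wherever the walk goes in `es`.
walk-level : ∀ {u v} → Walk es ds u v → level es (toℕ v) ≡ net ds +ᶻ level es (toℕ u)
walk-level [] = sym (ℤ.+-identityˡ _)
walk-level {es = es} {ds = d ∷ ds} {u = u} (_∷_ {v = v} {w} s p) = begin
  level es (toℕ w)                       ≡⟨ walk-level p ⟩
  net ds +ᶻ level es (toℕ v)             ≡⟨ cong (λ l → net ds +ᶻ l) (step-level s) ⟩
  net ds +ᶻ (step d +ᶻ level es (toℕ u))
    ≡⟨ x∙yz≈y∙xz ℤ.+-commutativeSemigroup (net ds) (step d) (level es (toℕ u)) ⟩
  step d +ᶻ (net ds +ᶻ level es (toℕ u)) ≡⟨ ℤ.+-assoc (step d) (net ds) (level es (toℕ u)) ⟨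
  (step d +ᶻ net ds) +ᶻ level es (toℕ u) ∎
  where open ≡-Reasoning

arc-near : ∀ {u v} → PathArc es u v → toℕ v ≤ suc (toℕ u) × toℕ u ≤ suc (toℕ v)
arc-near a with arc-adjacent a
... | inj₁ p = ≤-reflexive p , ≤-trans (n≤1+n _) (≤-trans (≤-reflexive (sym p)) (n≤1+n _))
... | inj₂ p = ≤-trans (n≤1+n _) (≤-trans (≤-reflexive (sym p)) (n≤1+n _)) , ≤-reflexive p

step-near : ∀ {u v} → Step es d u v → toℕ v ≤ suc (toℕ u)
step-near (forward a)  = proj₁ (arc-near a)
step-near (backward a) = proj₂ (arc-near a)

walk-near : ∀ {u v} → Walk es ds u v → toℕ v ≤ length ds + toℕ u
walk-near [] = ≤-refl
walk-near {ds = d ∷ ds} {u = u} (s ∷ p) = ≤-trans (walk-near p)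
  (≤-trans (+-monoʳ-≤ (length ds) (step-near s)) (≤-reflexive (+-suc (length ds) (toℕ u))))

walk-peak-level : ∀ n {u v} → Walk es (peak n) u v → level es (toℕ v) ≡ level es (toℕ u)
walk-peak-level {es} n {u} p =
  trans (walk-level p) (trans (cong (_+ᶻ level es (toℕ u)) (net-peak n)) (ℤ.+-identityˡ _))

-- Crossing a peak

module Peak {es as bs : List Direction} {n : ℕ} (es≡ : es ≡ as ++ peak (suc n) ++ bs) where

  private
    top : ℕ
    top = length as + suc n

  slope : ∀ {s} → s ≤ suc n → level es (length as + s) ≡ net as +ᶻ + s
  slope {s} s≤n = trans (cong (λ l → level l (length as + s)) es≡)
    (trans (level-++-past as _ s) (cong (λ l → net as +ᶻ l) (level-slope (suc n) bs s≤n)))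

  slope-injective : ∀ {s t} → net as +ᶻ + s ≡ net as +ᶻ + t → s ≡ t
  slope-injective eq = ℤ.+-injective (∙-cancelˡ (net as) _ _ eq)

  -- Both neighbours of the top lie one level below it, whereas an arc leaving it would lead one
  -- level above.
  top-sink : ∀ {u v} → PathArc es u v → toℕ u ≢ top
  top-sink {u} {v} a u≡top = m≢1+m+n n {1} (slope-injective (begin
    net as +ᶻ + n             ≡⟨ below (arc-adjacent a) ⟨
    level es (toℕ v)          ≡⟨ arc-level a ⟩
    1ℤ +ᶻ level es (toℕ u)    ≡⟨ cong (λ m → 1ℤ +ᶻ level es m) u≡top ⟩
    1ℤ +ᶻ level es top        ≡⟨ cong (1ℤ +ᶻ_) (slope ≤-refl) ⟩
    1ℤ +ᶻ (net as +ᶻ + suc n) ≡⟨ x∙yz≈y∙xz ℤ.+-commutativeSemigroup 1ℤ (net as) (+ suc n) ⟩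
    net as +ᶻ + suc (suc n)   ≡⟨ cong (λ m → net as +ᶻ + suc m) (+-comm 1 n) ⟩
    net as +ᶻ + suc (n + 1) ∎))
    where
    open ≡-Reasoning
    below : toℕ v ≡ suc (toℕ u) ⊎ toℕ u ≡ suc (toℕ v) → level es (toℕ v) ≡ net as +ᶻ + n
    below (inj₁ v≡1+u) = begin
      level es (toℕ v)
        ≡⟨ cong (level es) (trans v≡1+u (trans (cong suc u≡top) (+-comm 1 top))) ⟩
      level es (top + 1)
        ≡⟨ cong (level es) (+-assoc (length as) (suc n) 1) ⟩
      level es (length as + (suc n + 1))
        ≡⟨ cong (λ l → level l (length as + (suc n + 1))) es≡ ⟩
      level (as ++ peak (suc n) ++ bs) (length as + (suc n + 1)) ≡⟨ level-++-past as _ (suc n + 1) ⟩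
      net as +ᶻ level (peak (suc n) ++ bs) (suc n + 1)
        ≡⟨ cong (λ l → net as +ᶻ l) (level-past-top n bs) ⟩
      net as +ᶻ + n ∎
    below (inj₂ u≡1+v) = trans
      (cong (level es) (suc-injective (trans (sym u≡1+v) (trans u≡top (+-suc (length as) n)))))
      (slope (n≤1+n n))

  -- Steps move by at most one vertex, so getting past the top requires an arc that leaves it.
  climb : ∀ m {u v} → Walk es (replicate m forward) u v → toℕ u ≤ top → toℕ v ≤ top
  climb zero    []                u≤top = u≤top
  climb (suc m) (s@(forward a) ∷ p) u≤top =
    climb m p (≤-trans (step-near s) (≤∧≢⇒< u≤top (top-sink a)))

  -- A backward step lands on the tail of an arc, which the top never is.
  descend : ∀ m {u v} → Walk es (replicate m backward) u v → toℕ u < top → toℕ v < top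
  descend zero    []                   u<top = u<top
  descend (suc m) (s@(backward a) ∷ p) u<top =
    descend m p (≤∧≢⇒< (≤-trans (step-near s) u<top) (top-sink a))

  -- The level rises strictly along the slope, so beyond the foot it exceeds `net as` up to the top.
  left-of-slope : ∀ {w} → w < top → level es w ≡ net as → w ≤ length as
  left-of-slope {w} w<top w-level with w ≤? length as
  ... | yes p = p
  ... | no ¬p = m∸n≡0⇒m≤n (slope-injective (begin
    net as +ᶻ + (w ∸ length as)            ≡⟨ slope (m≤n+o⇒m∸n≤o w (length as) (<⇒≤ w<top)) ⟨
    level es (length as + (w ∸ length as)) ≡⟨ cong (level es) (m+[n∸m]≡n (<⇒≤ (≰⇒> ¬p))) ⟩
    level es w                             ≡⟨ w-level ⟩
    net as                                 ≡⟨ ℤ.+-identityʳ (net as) ⟨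
    net as +ᶻ 0ℤ ∎))
    where open ≡-Reasoning

  -- The vertex reached after the `m` forward steps decides. At the top, levels give `m ≡ suc n`,
  -- and the descent is just long enough for the far foot. Elsewhere the walk stays left of the top
  -- and ends at the level of the foot.
  walk-peak : ∀ m {u w} → Walk es (peak m) u w → toℕ u ≤ length as → level es (toℕ u) ≡ net as →
    toℕ w ≤ length as ⊎ (m ≡ suc n × toℕ w ≤ length (as ++ peak (suc n)))
  walk-peak m {u} {w} p u≤ u-level with walk-split (replicate m forward) p
  ... | v , q , r with toℕ v ≟ top
  ...   | yes v≡top = inj₂ (m≡1+n , (let open ≤-Reasoning in begin
      toℕ w                                 ≤⟨ walk-near r ⟩
      length (replicate m backward) + toℕ v ≡⟨ cong₂ _+_ (trans (length-replicate m) m≡1+n) v≡top ⟩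
      suc n + (length as + suc n)           ≡⟨ +-comm (suc n) _ ⟩
      length as + suc n + suc n             ≡⟨ +-assoc (length as) (suc n) (suc n) ⟩
      length as + (suc n + suc n)           ≡⟨ cong (λ l → length as + l) (length-peak (suc n)) ⟨
      length as + length (peak (suc n))     ≡⟨ length-++ as ⟨
      length (as ++ peak (suc n)) ∎))
    where
    m≡1+n : m ≡ suc n
    m≡1+n = slope-injective (let open ≡-Reasoning in begin
      net as +ᶻ + m                                 ≡⟨ ℤ.+-comm (net as) (+ m) ⟩
      + m +ᶻ net as                                 ≡⟨ cong₂ _+ᶻ_ (net-forward m) u-level ⟨
      net (replicate m forward) +ᶻ level es (toℕ u) ≡⟨ walk-level q ⟨
      level es (toℕ v)                              ≡⟨ cong (level es) v≡top ⟩
      level es top                                  ≡⟨ slope ≤-refl ⟩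
      net as +ᶻ + suc n ∎)
  ...   | no v≢top = inj₁ (left-of-slope
      (descend m r (≤∧≢⇒< (climb m q (≤-trans u≤ (m≤m+n (length as) (suc n)))) v≢top))
      (trans (walk-peak-level m p) u-level))

-- Mountains

-- Naming the level as a natural number bounds it from below by zero as well.
Within : ℕ → List Direction → Set
Within H ds = ∀ s → ∃ λ k → level ds s ≡ + k × k ≤ H

peak-within : ∀ {H n} → n ≤ H → Within H (peak n)
peak-within {H} {n} n≤H s with s ≤? n
... | yes s≤n = s , trans (cong (λ l → level l s) (sym (++-identityʳ (peak n)))) (level-slope n [] s≤n)
                  , ≤-trans s≤n n≤H
... | no s≰n  = n ∸ t ⊓ n , (begin
    level (peak n) s
      ≡⟨ cong (level (peak n)) (m+[n∸m]≡n len≤s) ⟨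
    level (peak n) (len + t)
      ≡⟨ level-++-past (replicate n forward) _ t ⟩
    net (replicate n forward) +ᶻ level (replicate n backward) t
      ≡⟨ cong₂ _+ᶻ_ (net-forward n) (level-backward n t) ⟩
    + n +ᶻ -ᶻ + (t ⊓ n)                                         ≡⟨ ℤ.[+m]-[+n]≡m⊖n n (t ⊓ n) ⟩
    n ⊖ (t ⊓ n)                                                 ≡⟨ ℤ.⊖-≥ (m⊓n≤n t n) ⟩
    + (n ∸ t ⊓ n) ∎)
  , ≤-trans (m∸n≤m n (t ⊓ n)) n≤H
  where
  open ≡-Reasoning
  len = length (replicate n forward)
  t = s ∸ len
  len≤s : len ≤ s
  len≤s = subst (_≤ s) (sym (length-replicate n)) (<⇒≤ (≰⇒> s≰n))

level-++-balanced : ∀ as bs s → net as ≡ 0ℤ →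
  level (as ++ bs) s ≡ level as s ⊎
  ∃ λ t → s ≡ length as + t × level (as ++ bs) s ≡ level bs t
level-++-balanced as bs s balanced with s ≤? length as
... | yes s≤ = inj₁ (begin
    level (as ++ bs) s                     ≡⟨ level-++ as bs s ⟩
    level as s +ᶻ level bs (s ∸ length as) ≡⟨ cong (λ m → level as s +ᶻ level bs m) (m≤n⇒m∸n≡0 s≤) ⟩
    level as s +ᶻ 0ℤ                       ≡⟨ ℤ.+-identityʳ _ ⟩
    level as s ∎)
  where open ≡-Reasoning
... | no s≰  = inj₂ (t , s≡ , (begin
    level (as ++ bs) s               ≡⟨ cong (level (as ++ bs)) s≡ ⟩
    level (as ++ bs) (length as + t) ≡⟨ level-++-past as bs t ⟩
    net as +ᶻ level bs t             ≡⟨ cong (λ l → l +ᶻ level bs t) balanced ⟩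
    0ℤ +ᶻ level bs t                 ≡⟨ ℤ.+-identityˡ _ ⟩
    level bs t ∎))
  where
  open ≡-Reasoning
  t = s ∸ length as
  s≡ : s ≡ length as + t
  s≡ = sym (m+[n∸m]≡n (<⇒≤ (≰⇒> s≰)))

net-peaks : ∀ ∂ → net (concatMap peak ∂) ≡ 0ℤ
net-peaks []      = refl
net-peaks (d ∷ ∂) = trans (net-++ (peak d) (concatMap peak ∂)) (cong₂ _+ᶻ_ (net-peak d) (net-peaks ∂))

peaks-within : ∀ {H ∂} → All (_≤ H) ∂ → Within H (concatMap peak ∂)
peaks-within []                s = 0 , level-beyond [] {s} z≤n , z≤n
peaks-within {∂ = d ∷ ∂} (d≤H ∷ ∂≤H) s with level-++-balanced (peak d) (concatMap peak ∂) s (net-peak d)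
... | inj₁ eq with k , eq′ , k≤H ← peak-within d≤H s = k , trans eq eq′ , k≤H
... | inj₂ (t , _ , eq) with k , eq′ , k≤H ← peaks-within ∂≤H t = k , trans eq eq′ , k≤H

module _ (H : ℕ) where

  ascent : List Direction
  ascent = replicate H forward ++ forward ∷ []

  length-ascent : length ascent ≡ suc H
  length-ascent = trans (length-++ (replicate H forward))
    (trans (cong (_+ 1) (length-replicate H)) (+-comm H 1))

  level-ascent : ∀ s → level ascent s ≡ + (s ⊓ suc H)
  level-ascent = go H
    where
    go : ∀ n s → level (replicate n forward ++ forward ∷ []) s ≡ + (s ⊓ suc n)
    go n       zero          = refl
    go zero    (suc zero)    = refl
    go zero    (suc (suc s)) = refl
    go (suc n) (suc s)       = cong (1ℤ +ᶻ_) (go n s)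

  -- For `H = h ∸ 2` this is definitionally the direction list of `mountain h ∂`.
  path : List ℕ → List Direction
  path ∂ = forward ∷ concatMap peak ∂ ++ ascent

  net-path : ∀ ∂ → net (path ∂) ≡ + (2 + H)
  net-path ∂ = cong (1ℤ +ᶻ_) (begin
    net (concatMap peak ∂ ++ ascent)     ≡⟨ net-++ (concatMap peak ∂) ascent ⟩
    net (concatMap peak ∂) +ᶻ net ascent
      ≡⟨ cong₂ _+ᶻ_ (net-peaks ∂)
          (trans (level-ascent _) (cong +_ (m≥n⇒m⊓n≡n (≤-reflexive (sym length-ascent))))) ⟩
    + (1 + H) ∎)
    where open ≡-Reasoning

  -- The opening arc lifts the peaks to levels between `1` and `1 + H`, so the extreme levels `0`
  -- and `2 + H` occur only at the two ends.
  level-path : ∀ {∂} → All (_≤ H) ∂ → ∀ s → ∃ λ k → level (path ∂) s ≡ + k × k ≤ 2 + H ×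
    (0 < s → 0 < k) × (s < length (path ∂) → k < 2 + H)
  level-path ∂≤H zero = 0 , refl , z≤n , (λ ()) , (λ _ → s≤s z≤n)
  level-path {∂} ∂≤H (suc s) with level-++-balanced (concatMap peak ∂) ascent s (net-peaks ∂)
  ... | inj₁ eq with k , eq′ , k≤H ← peaks-within ∂≤H s =
    suc k , cong (1ℤ +ᶻ_) (trans eq eq′) , s≤s (m≤n⇒m≤1+n k≤H) , (λ _ → s≤s z≤n) , (λ _ → s≤s (s≤s k≤H))
  ... | inj₂ (t , s≡ , eq) =
    suc (t ⊓ suc H) , cong (1ℤ +ᶻ_) (trans eq (level-ascent t)) , s≤s (m⊓n≤n t (suc H))
    , (λ _ → s≤s z≤n) , (λ { (s≤s s<) → s≤s (≤-<-trans (m⊓n≤m t (suc H)) (t< s<)) })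
    where
    t< : s < length (concatMap peak ∂ ++ ascent) → t < suc H
    t< s< = +-cancelˡ-< (length (concatMap peak ∂)) t (suc H)
      (subst₂ _<_ s≡ (trans (length-++ (concatMap peak ∂))
        (cong (λ m → length (concatMap peak ∂) + m) length-ascent)) s<)

  -- The walk rises by `2 + H`, the whole range of levels, so it must run from the lowest to the
  -- highest.
  walk-ends : ∀ {∂ ∂′ u w} → All (_≤ H) ∂′ → Walk (path ∂′) (path ∂) u w →
    toℕ u ≡ 0 × length (path ∂′) ≤ toℕ w
  walk-ends {∂} {∂′} {u} {w} ∂′≤H p
    with a , level-u , _    , 0<u⇒0<a , _    ← level-path ∂′≤H (toℕ u)
       | b , level-w , b≤2+H , _       , w<⇒b< ← level-path ∂′≤H (toℕ w)
    = n≮0⇒n≡0 (λ 0<u → <⇒≱ (≤-trans (m<m+n (2 + H) (0<u⇒0<a 0<u)) (≤-reflexive (sym b≡))) b≤2+H)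
    , ≮⇒≥ (λ w< → <⇒≱ (w<⇒b< w<) (≤-trans (m≤m+n (2 + H) a) (≤-reflexive (sym b≡))))
    where
    n≮0⇒n≡0 : ∀ {n} → ¬ 0 < n → n ≡ 0
    n≮0⇒n≡0 = n≤0⇒n≡0 ∘ ≮⇒≥
    b≡ : b ≡ 2 + H + a
    b≡ = ℤ.+-injective (trans (sym level-w) (trans (walk-level p) (cong₂ _+ᶻ_ (net-path ∂) level-u)))

  -- A walk that crosses no peak of ∂′ for one of its own can no longer reach the
  -- end, since at most one peak of ∂′ is crossed for each peak of ∂.
  walk-peaks : ∀ {es} ∂ ∂′ as {u w} → All (1 ≤_) ∂′ → length ∂ ≤ length ∂′ →
    es ≡ as ++ concatMap peak ∂′ ++ ascent → Walk es (concatMap peak ∂ ++ ascent) u w →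
    toℕ u ≤ length as → level es (toℕ u) ≡ net as → length es ≤ toℕ w → ∂ ≡ ∂′
  walk-peaks []      []               as _ _ _ _ _ _ _ = refl
  -- Only the ascent is left to walk, too few steps to cover a peak and the ascent of `es`.
  walk-peaks {es} [] (suc n ∷ ∂′)     as {u} {w} (s≤s _ ∷ _) _ es≡ p u≤ _ w≥ = contradiction (begin-strict
    length ascent + length as                   ≡⟨ +-comm (length ascent) (length as) ⟩
    length as + length ascent
      <⟨ +-monoʳ-< (length as) (s≤s (≤-trans (m≤n+m (length ascent) (length qs))
          (≤-reflexive (sym (length-++ qs))))) ⟩
    length as + length (forward ∷ qs ++ ascent) ≡⟨ length-++ as ⟨
    length (as ++ forward ∷ qs ++ ascent)       ≡⟨ cong length es≡ ⟨
    length es                                   ≤⟨ w≥ ⟩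
    toℕ w                                       ≤⟨ walk-near p ⟩
    length ascent + toℕ u                       ≤⟨ +-monoʳ-≤ (length ascent) u≤ ⟩
    length ascent + length as ∎) (<-irrefl refl)
    where
    open ≤-Reasoning
    qs = (replicate n forward ++ replicate (suc n) backward) ++ concatMap peak ∂′
  walk-peaks {es} (d ∷ ∂) (suc n ∷ ∂′) as {u} (s≤s 0≤n ∷ ∂′≥1) (s≤s len) es≡ p u≤ level-u w≥
    with v , q , r ← walk-split (peak d) (subst (λ l → Walk es l _ _) (++-assoc (peak d) _ ascent) p)
    with Peak.walk-peak {n = n} es≡′ d q u≤ level-u
    where
    es≡′ : es ≡ as ++ peak (suc n) ++ concatMap peak ∂′ ++ ascent
    es≡′ = trans es≡ (cong (as ++_) (++-assoc (peak (suc n)) (concatMap peak ∂′) ascent))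
  -- No peak was crossed: the induction hypothesis for the same target peaks gives `∂ ≡ suc n ∷ ∂′`,
  -- which `len` forbids.
  ... | inj₁ v≤ = contradiction len (<⇒≱ (≤-reflexive (sym (cong length
    (walk-peaks ∂ (suc n ∷ ∂′) as (s≤s 0≤n ∷ ∂′≥1) (m≤n⇒m≤1+n len) es≡ r v≤
      (trans (walk-peak-level d q) level-u) w≥)))))
  ... | inj₂ (refl , v≤) = cong (d ∷_)
    (walk-peaks ∂ ∂′ (as ++ peak d) ∂′≥1 len es≡″ r v≤ level-v w≥)
    where
    es≡″ : es ≡ (as ++ peak d) ++ concatMap peak ∂′ ++ ascent
    es≡″ = trans es≡ (trans (cong (as ++_) (++-assoc (peak d) (concatMap peak ∂′) ascent))
      (sym (++-assoc as (peak d) _)))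
    level-v : level es (toℕ v) ≡ net (as ++ peak d)
    level-v = begin
      level es (toℕ v)       ≡⟨ walk-peak-level d q ⟩
      level es (toℕ u)       ≡⟨ level-u ⟩
      net as                 ≡⟨ ℤ.+-identityʳ (net as) ⟨
      net as +ᶻ 0ℤ           ≡⟨ cong (λ l → net as +ᶻ l) (net-peak d) ⟨
      net as +ᶻ net (peak d) ≡⟨ net-++ as (peak d) ⟨
      net (as ++ peak d) ∎
      where open ≡-Reasoning

-- Homomorphisms

-- Source and target are separate because inductions shorten the source path and keep the target.
ArcPreserving : (ds es : List Direction) → (Fin (suc (length ds)) → Fin (suc (length es))) → Set
ArcPreserving ds es g = ∀ {u v} → PathArc ds u v → PathArc es (g u) (g v)

image-step : ∀ {g} → ArcPreserving (d ∷ ds) es g → Step es d (g zero) (g (suc zero))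
image-step {forward}  mono = forward  (mono forward)
image-step {backward} mono = backward (mono backward)

image-walk : ∀ {g} → ArcPreserving ds es g → Walk es ds (g zero) (g (fromℕ (length ds)))
image-walk {[]}     mono = []
image-walk {d ∷ ds} mono = image-step mono ∷ image-walk (mono ∘ later)

image-near-start : ∀ {g} → ArcPreserving ds es g → ∀ x → toℕ (g x) ≤ toℕ x + toℕ (g zero)
image-near-start mono zero = ≤-refl
image-near-start {d ∷ ds} {es} {g} mono (suc x) = begin
  toℕ (g (suc x))            ≤⟨ image-near-start {g = g ∘ suc} (mono ∘ later) x ⟩
  toℕ x + toℕ (g (suc zero)) ≤⟨ +-monoʳ-≤ (toℕ x) (step-near (image-step mono)) ⟩
  toℕ x + suc (toℕ (g zero)) ≡⟨ +-suc (toℕ x) _ ⟩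
  suc (toℕ x) + toℕ (g zero) ∎
  where open ≤-Reasoning

image-near-end : ∀ {g} → ArcPreserving ds es g → ∀ x →
  toℕ (g (fromℕ (length ds))) + toℕ x ≤ length ds + toℕ (g x)
image-near-end {g = g} mono zero = ≤-trans (≤-reflexive (+-identityʳ _)) (walk-near (image-walk mono))
image-near-end {d ∷ ds} {g = g} mono (suc x) = ≤-trans (≤-reflexive (+-suc _ (toℕ x)))
  (s≤s (image-near-end {g = g ∘ suc} (mono ∘ later) x))

-- The image of `x` is at most `x` steps from the start and at most `length ds ∸ x` from the end,
-- which pins it down.
fixes-ends⇒identity : ∀ {g} → ArcPreserving ds ds g → toℕ (g zero) ≡ 0 →
  length ds ≤ toℕ (g (fromℕ (length ds))) → ∀ x → g x ≡ x
fixes-ends⇒identity {ds} {g} mono start end x = toℕ-injective (≤-antisym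
  (≤-trans (image-near-start mono x) (≤-reflexive (trans (cong (λ m → toℕ x + m) start) (+-identityʳ _))))
  (+-cancelˡ-≤ (length ds) _ _ (≤-trans (+-monoˡ-≤ (toℕ x) end) (image-near-end mono x))))

mountain-antichain : ∀ {h ∂ ∂′ g} → All (λ d → 1 ≤ d × d ≤ h ∸ 2) ∂′ → length ∂ ≡ length ∂′ →
  IsHomomorphism (mountain h ∂) (mountain h ∂′) g → ∂ ≡ ∂′
mountain-antichain {h} {∂} {∂′} {g} bounds len g-hom
  with p ← image-walk {path (h ∸ 2) ∂} {path (h ∸ 2) ∂′} (IsOrderHomomorphism.mono g-hom)
  with start , end ← walk-ends (h ∸ 2) {∂} {∂′} (All.map proj₂ bounds) p
  with s ∷ q ← p
  -- The opening arc is split off on both sides, so the comparison of peaks starts at level one.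
  = walk-peaks (h ∸ 2) ∂ ∂′ (forward ∷ []) (All.map proj₁ bounds) (≤-reflexive len) refl q
      (≤-trans (step-near s) (s≤s (≤-reflexive start)))
      (trans (step-level s) (cong (λ n → 1ℤ +ᶻ level (path (h ∸ 2) ∂′) n) start))
      end

mountain-rigid : ∀ {h ∂ g} → All (λ d → 1 ≤ d × d ≤ h ∸ 2) ∂ →
  IsHomomorphism (mountain h ∂) (mountain h ∂) g → ∀ x → g x ≡ x
mountain-rigid {h} {∂} {g} bounds g-hom
  with start , end ← walk-ends (h ∸ 2) {∂} {∂} (All.map proj₂ bounds)
                       (image-walk (IsOrderHomomorphism.mono g-hom))
  = fixes-ends⇒identity (IsOrderHomomorphism.mono g-hom) start end

pathColour : ∀ {n} → Fin n → Bool
pathColour zero    = true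
pathColour (suc u) = not (pathColour u)

arc-alternates : ∀ {u v} → PathArc es u v → pathColour v ≡ not (pathColour u)
arc-alternates forward   = refl
arc-alternates backward  = refl
arc-alternates (later a) = cong not (arc-alternates a)

arrow-orientedBipartite : ∀ {ds} → OrientedBipartite (orientedPath (forward ∷ ds))
arrow-orientedBipartite = record
  { colour      = pathColour
  ; colour-cong = cong pathColour
  ; alternates  = arc-alternates
  ; asym        = arc-asym
  ; arc         = forward
  }

-- The index set

-- All sequences of length `n` with entries at most `b`, a finite list large enough to contain every
-- index sequence.
sequences : ℕ → ℕ → List (List ℕ)
sequences b zero    = [] ∷ []
sequences b (suc n) = cartesianProductWith _∷_ (upTo (suc b)) (sequences b n)

∈-sequences : ∀ {b xs} → All (_≤ b) xs → xs ∈ sequences b (length xs)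
∈-sequences []         = here refl
∈-sequences (x≤b ∷ ps) = ∈-cartesianProductWith⁺ _∷_ (∈-upTo⁺ (s≤s x≤b)) (∈-sequences ps)

module _ {h ℓ : ℕ} where

  ∂-injective : Injective _≡_ _≡_ (DM.∂ {h} {ℓ})
  ∂-injective {record { ∂ = _ }} {record { ∂ = _ }} refl = refl

  -- The irrelevant field is recovered by deciding the equality.
  ∂-length : ∀ (m : DM h ℓ) → length (DM.∂ m) ≡ ℓ
  ∂-length record { ∂ = ∂ ; length-∂ = length-∂ } = recompute (length ∂ ≟ ℓ) length-∂

  ∂-bounded : ∀ (m : DM h ℓ) → All (λ d → 1 ≤ d × d ≤ h ∸ 2) (DM.∂ m)
  ∂-bounded record { ∂ = ∂ ; bounded = bounded } =
    recompute (All.all? (λ d → 1 ≤? d ×-dec d ≤? h ∸ 2) ∂) bounded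

  ∂∈sequences : ∀ (m : DM h ℓ) → DM.∂ m ∈ sequences (h ∸ 2) ℓ
  ∂∈sequences m = subst (λ n → DM.∂ m ∈ sequences (h ∸ 2) n) (∂-length m)
    (∈-sequences (All.map proj₂ (∂-bounded m)))

theorem42 : (h ℓ : ℕ) → 1 ≤ h → 1 ≤ ℓ → h > ℓ + 2 →
    IsCore (∏ {I = DM h ℓ} (λ m → cone (M m)))
theorem42 h ℓ _ _ _ φ (φ-hom , _) = endomorphism-identity
  (λ {k} {j} g-hom → ∂-injective
    (mountain-antichain {h} (∂-bounded j) (trans (∂-length k) (sym (∂-length j))) g-hom))
  (λ {j} g-hom → mountain-rigid {h} (∂-bounded j) g-hom)
  φ-hom
  where
  open ConeProduct (M {h} {ℓ}) (λ _ → arrow-orientedBipartite)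
    (≡-dec _≟_) DM.∂ ∂-injective (sequences (h ∸ 2) ℓ) ∂∈sequences
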